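{- A countable monounary algebra is $\omega$-categorical if and only if it is locally finite and has finitely many $1$-orbits.
   Context: A monounary algebra is a pair $\mathcal{A}=(A;\theta)$ where $A$ is a nonempty set and $\theta\colon A\to A$. It is locally finite if every finitely generated subalgebra (nonempty subset closed under $\theta$) is finite. The $1$-orbits of $\mathcal{A}$ are the orbits of the automorphism group $\mathrm{Aut}(\mathcal{A})$ on $A$. A countable structure is $\omega$-categorical if every countable structure with the same first-order theory is isomorphic to it; equivalently (Ryll-Nardzewski), its automorphism group has only finitely many orbits on $n$-tuples for every $n\geq 1$. -}

module Defs where

open import Level using (0ℓ)
open import Data.Nat.Base using (ℕ; suc)
open import Data.Fin.Base using (Fin)
open import Data.Vec.Base using (Vec; []; _∷_; lookup)
open import Data.List.Base using (List)
open import Data.List.Membership.Propositional using () renaming (_∈_ to _∈ₗ_)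
open import Data.List.Relation.Unary.Any using (Any)
open import Data.Empty using (⊥)
open import Data.Product.Base using (Σ-syntax; ∃-syntax; proj₁)
open import Function.Bundles using (_↣_; _↔_; _⇔_; Inverse)
open import Relation.Binary.PropositionalEquality.Core using (_≡_)
open import Relation.Unary using (Pred; _⊆_; _≐_; Satisfiable)

record MonounaryAlgebra : Set₁ where
  field
    Carrier  : Set
    θ        : Carrier → Carrier
    -- Witnesses nonemptiness only: morphisms need not preserve it.
    nonempty : Carrier

open MonounaryAlgebra using (Carrier)

-- Finite or countably infinite.
Countable : MonounaryAlgebra → Set
Countable 𝒜 = Carrier 𝒜 ↣ ℕ

infix 4 _≅_

_≅_ : MonounaryAlgebra → MonounaryAlgebra → Set
𝒜 ≅ ℬ = Σ[ f ∈ Carrier 𝒜 ↔ Carrier ℬ ]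
          (∀ x → Inverse.to f (A.θ x) ≡ B.θ (Inverse.to f x))
  where
  module A = MonounaryAlgebra 𝒜
  module B = MonounaryAlgebra ℬ

Automorphism : MonounaryAlgebra → Set
Automorphism 𝒜 = 𝒜 ≅ 𝒜

-- First-order logic with equality over one unary function symbol.
-- Variables are de Bruijn indices; n bounds the free variables.

data Term (n : ℕ) : Set where
  var : Fin n → Term n
  θ·_ : Term n → Term n

infix  6 _≈′_
infixr 5 _⇒′_

-- ⊥, ⇒ and ∀ generate the remaining connectives and ∃ classically.
data Formula (n : ℕ) : Set where
  _≈′_ : Term n → Term n → Formula n
  ⊥′   : Formula n
  _⇒′_ : Formula n → Formula n → Formula n
  ∀′_  : Formula (suc n) → Formula n

Sentence : Set
Sentence = Formula 0

module _ (𝒜 : MonounaryAlgebra) where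
  open MonounaryAlgebra 𝒜 using (θ) renaming (Carrier to A)

  ⟦_⟧ : ∀ {n} → Term n → Vec A n → A
  ⟦ var i ⟧ ρ = lookup ρ i
  ⟦ θ· t  ⟧ ρ = θ (⟦ t ⟧ ρ)

  Satisfies : ∀ {n} → Vec A n → Formula n → Set
  Satisfies ρ (s ≈′ t) = ⟦ s ⟧ ρ ≡ ⟦ t ⟧ ρ
  Satisfies ρ ⊥′       = ⊥
  Satisfies ρ (φ ⇒′ ψ) = Satisfies ρ φ → Satisfies ρ ψ
  Satisfies ρ (∀′ φ)   = ∀ a → Satisfies (a ∷ ρ) φ

infix 4 _⊨_ _≡ₑ_

_⊨_ : MonounaryAlgebra → Sentence → Set
𝒜 ⊨ φ = Satisfies 𝒜 [] φ

_≡ₑ_ : MonounaryAlgebra → MonounaryAlgebra → Set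
𝒜 ≡ₑ ℬ = ∀ φ → (𝒜 ⊨ φ) ⇔ (ℬ ⊨ φ)

ωCategorical : MonounaryAlgebra → Set₁
ωCategorical 𝒜 = ∀ ℬ → Countable ℬ → 𝒜 ≡ₑ ℬ → 𝒜 ≅ ℬ

module _ (𝒜 : MonounaryAlgebra) where
  open MonounaryAlgebra 𝒜 using (θ) renaming (Carrier to A)

  record Subalgebra : Set₁ where
    field
      Member    : Pred A 0ℓ
      inhabited : Satisfiable Member
      closed    : ∀ {x} → Member x → Member (θ x)

  data ⟨_⟩ (xs : List A) : Pred A 0ℓ where
    generator : ∀ {x} → x ∈ₗ xs → ⟨ xs ⟩ x
    apply     : ∀ {x} → ⟨ xs ⟩ x → ⟨ xs ⟩ (θ x)

  FinitelyGenerated : Subalgebra → Set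
  FinitelyGenerated S = ∃[ xs ] Subalgebra.Member S ≐ ⟨ xs ⟩

  -- Some list enumerates all members (possibly with repetitions and
  -- non-members).
  Finite : Subalgebra → Set
  Finite S = ∃[ ys ] Subalgebra.Member S ⊆ (_∈ₗ ys)

  LocallyFinite : Set₁
  LocallyFinite = ∀ S → FinitelyGenerated S → Finite S

  SameOrbit : A → A → Set
  SameOrbit x y = Σ[ f ∈ Automorphism 𝒜 ] Inverse.to (proj₁ f) x ≡ y

  -- Some finite list meets every orbit of Aut 𝒜 on A.
  FinitelyMany1Orbits : Set
  FinitelyMany1Orbits = ∃[ rs ] ∀ x → Any (λ r → SameOrbit r x) rs

{-# OPTIONS --safe #-}

module Submission where

-- If 𝒜 is locally finite with finitely many 1-orbits, then it has finitely many orbits of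
-- n-tuples for every n: given a finite subalgebra S, two elements b, b′ of the same 1-orbit
-- whose forward orbits enter S at the same time and place (or never) are exchanged by an
-- automorphism fixing S pointwise, namely one that swaps the components of b and b′ in the
-- partial algebra A ∖ S; eventual periodicity bounds the entry time. Finitely many types of
-- tuples make every type isolated, and back-and-forth gives ω-categoricity.
--
-- Conversely, omitting types shows that the tuples of an ω-categorical 𝒜 have isolated types,
-- so 𝒜 is homogeneous, and compactness then leaves only finitely many types of pairs. Since
-- the type of (x , θᵏ x) determines θᵏ x over x, forward orbits are finite.

open import Defs
open import Level using (0ℓ)
open import Axiom.ExcludedMiddle using (ExcludedMiddle)
open import Data.Empty using (⊥; ⊥-elim)
open import Data.Fin.Base using (Fin; zero; suc; toℕ; _↑ˡ_; _↑ʳ_)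
open import Data.Fin.Properties using (toℕ-injective; pigeonhole; toℕ-fromℕ<)
open import Data.List.Base
  using (List; []; _∷_; length; applyUpTo; upTo; concatMap; cartesianProduct)
  renaming (map to mapₗ; lookup to lookupₗ; _++_ to _++ₗ_)
open import Data.List.Membership.Propositional using (_∈_; lose)
open import Data.List.Membership.Propositional.Properties
  using (∈-map⁺; ∈-cartesianProduct⁺; ∈-upTo⁺; ∈-applyUpTo⁺; ∈-applyUpTo⁻)
open import Data.List.Relation.Unary.All as All using (All; []; _∷_)
import Data.List.Relation.Unary.All.Properties as All
open import Data.List.Relation.Unary.Any as Any using (Any; here; there; index)
import Data.List.Relation.Unary.Any.Properties as Any
open import Data.Maybe.Base using (Maybe; just; nothing)
open import Data.Nat.Base
  using (ℕ; zero; suc; _+_; _∸_; _≤_; _<_; _⊔_; _≤′_; ≤′-refl; ≤′-step; z≤n; s≤s)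
open import Data.Nat.DivMod using (_mod_; _%_; m<n⇒m%n≡m)
open import Data.Nat.Induction using (<-rec)
open import Data.Nat.Properties
  using (+-suc; +-identityʳ; suc-injective; ≤⇒≤′; m≤m⊔n; m≤n⊔m; m∸n+n≡m; +-monoʳ-<; ≮⇒≥; ≰⇒>;
    ≤-refl; ≤-total; m≤n⇒m<n∨m≡n; ≤-trans; ≤-antisym; <⇒≢; m≤n⇒m≤1+n; ≡-irrelevant; _≟_;
    module ≤-Reasoning)
open import Data.Product.Base using (Σ-syntax; ∃-syntax; _×_; _,_; proj₁; proj₂)
open import Data.Product.Properties using (,-injective)
open import Data.Sum.Base using (_⊎_; inj₁; inj₂; [_,_]; swap)
open import Data.Unit.Base using (⊤; tt)
open import Data.Vec.Base using (Vec; []; _∷_; _++_; lookup; map; tabulate; toList; allFin; head)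
open import Data.Vec.Properties
  using (∷-injective; lookup-map; map-∘; map-cong; lookup-++ˡ; lookup-++ʳ; lookup∘tabulate;
    map-lookup-allFin)
open import Function.Base using (_∘_; id)
open import Function.Bundles using (_⇔_; _↣_; mk⇔; mk↣; mk↔ₛ′; Inverse; Injection; Equivalence)
open import Function.Construct.Composition using (_↔-∘_; _↣-∘_)
open import Function.Properties.Inverse using (↔⇒↣)
open import Function.Construct.Symmetry using (↔-sym)
open import Function.Construct.Identity using (↔-id)
open import Relation.Binary.PropositionalEquality
open import Relation.Nullary using (¬_; yes; no; contradiction)
open import Relation.Nullary.Decidable using (decidable-stable)

open MonounaryAlgebra using (Carrier; θ)

private variable
  k m n : ℕ
  X Y : Set
  𝒜 ℬ 𝒞 : MonounaryAlgebra

-- Countability of formulas with named variables.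

next : ℕ × ℕ → ℕ × ℕ
next (zero  , b) = suc b , zero
next (suc a , b) = a , suc b

unpair : ℕ → ℕ × ℕ
unpair zero    = 0 , 0
unpair (suc k) = next (unpair k)

-- `next` walks Cantor's antidiagonals, each from `(s , 0)` to `(0 , s)`. So `(suc a , 0)` is
-- preceded by the end `(0 , a)` of the previous diagonal, and the recursion is lexicographic in `s`
-- and `b`.
unpair-surjective : ∀ s a b → a + b ≡ s → ∃[ k ] unpair k ≡ (a , b)
unpair-surjective s zero zero _ = 0 , refl
unpair-surjective (suc s) (suc a) zero eq
  with k , p ← unpair-surjective s zero a (trans (sym (+-identityʳ a)) (suc-injective eq))
  = suc k , cong next p
unpair-surjective s a (suc b) eq
  with k , p ← unpair-surjective s (suc a) b (trans (sym (+-suc a b)) eq)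
  = suc k , cong next p

-- Opaque, so that unification treats pair as injective.
opaque
  pair : ℕ → ℕ → ℕ
  pair a b = proj₁ (unpair-surjective (a + b) a b refl)

  pair-injective : ∀ {a b c d} → pair a b ≡ pair c d → a ≡ c × b ≡ d
  pair-injective {a} {b} {c} {d} eq = ,-injective (begin
    (a , b)           ≡⟨ proj₂ (unpair-surjective (a + b) a b refl) ⟨
    unpair (pair a b) ≡⟨ cong unpair eq ⟩
    unpair (pair c d) ≡⟨ proj₂ (unpair-surjective (c + d) c d refl) ⟩
    (c , d)           ∎)
    where open ≡-Reasoning

⊎-countable : X ↣ ℕ → Y ↣ ℕ → (X ⊎ Y) ↣ ℕ
⊎-countable {X} {Y} f g = mk↣ injective
  where
  code : X ⊎ Y → ℕ
  code (inj₁ x) = pair 0 (Injection.to f x)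
  code (inj₂ y) = pair 1 (Injection.to g y)

  injective : ∀ {s t} → code s ≡ code t → s ≡ t
  injective {inj₁ _} {inj₁ _} eq = cong inj₁ (Injection.injective f (proj₂ (pair-injective eq)))
  injective {inj₁ _} {inj₂ _} eq with () ← proj₁ (pair-injective eq)
  injective {inj₂ _} {inj₁ _} eq with () ← proj₁ (pair-injective eq)
  injective {inj₂ _} {inj₂ _} eq = cong inj₂ (Injection.injective g (proj₂ (pair-injective eq)))

vecCode : Vec ℕ n → ℕ
vecCode []       = 0
vecCode (x ∷ xs) = pair x (vecCode xs)

vecCode-injective : {xs ys : Vec ℕ n} → vecCode xs ≡ vecCode ys → xs ≡ ys
vecCode-injective {xs = []}    {[]}    _  = refl
vecCode-injective {xs = _ ∷ _} {_ ∷ _} eq =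
  let p , q = pair-injective eq in cong₂ _∷_ p (vecCode-injective q)

termCode : Term n → ℕ
termCode (var i) = pair 0 (toℕ i)
termCode (θ· t)  = pair 1 (termCode t)

termCode-injective : {s t : Term n} → termCode s ≡ termCode t → s ≡ t
termCode-injective {s = var _} {var _} eq = cong var (toℕ-injective (proj₂ (pair-injective eq)))
termCode-injective {s = var _} {θ· _}  eq with () ← proj₁ (pair-injective eq)
termCode-injective {s = θ· _}  {var _} eq with () ← proj₁ (pair-injective eq)
termCode-injective {s = θ· _}  {θ· _}  eq = cong θ·_ (termCode-injective (proj₂ (pair-injective eq)))

formulaCode : Formula n → ℕ
formulaCode (s ≈′ t) = pair 0 (pair (termCode s) (termCode t))
formulaCode ⊥′       = pair 1 0
formulaCode (φ ⇒′ ψ) = pair 2 (pair (formulaCode φ) (formulaCode ψ))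
formulaCode (∀′ φ)   = pair 3 (formulaCode φ)

formulaCode-injective : {φ ψ : Formula n} → formulaCode φ ≡ formulaCode ψ → φ ≡ ψ
formulaCode-injective {φ = _ ≈′ _} {_ ≈′ _} eq =
  let p , q = pair-injective (proj₂ (pair-injective eq))
  in cong₂ _≈′_ (termCode-injective p) (termCode-injective q)
formulaCode-injective {φ = _ ≈′ _} {⊥′}     eq with () ← proj₁ (pair-injective eq)
formulaCode-injective {φ = _ ≈′ _} {_ ⇒′ _} eq with () ← proj₁ (pair-injective eq)
formulaCode-injective {φ = _ ≈′ _} {∀′ _}   eq with () ← proj₁ (pair-injective eq)
formulaCode-injective {φ = ⊥′}     {_ ≈′ _} eq with () ← proj₁ (pair-injective eq)
formulaCode-injective {φ = ⊥′}     {⊥′}     eq = refl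
formulaCode-injective {φ = ⊥′}     {_ ⇒′ _} eq with () ← proj₁ (pair-injective eq)
formulaCode-injective {φ = ⊥′}     {∀′ _}   eq with () ← proj₁ (pair-injective eq)
formulaCode-injective {φ = _ ⇒′ _} {_ ≈′ _} eq with () ← proj₁ (pair-injective eq)
formulaCode-injective {φ = _ ⇒′ _} {⊥′}     eq with () ← proj₁ (pair-injective eq)
formulaCode-injective {φ = _ ⇒′ _} {_ ⇒′ _} eq =
  let p , q = pair-injective (proj₂ (pair-injective eq))
  in cong₂ _⇒′_ (formulaCode-injective p) (formulaCode-injective q)
formulaCode-injective {φ = _ ⇒′ _} {∀′ _}   eq with () ← proj₁ (pair-injective eq)
formulaCode-injective {φ = ∀′ _}   {_ ≈′ _} eq with () ← proj₁ (pair-injective eq)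
formulaCode-injective {φ = ∀′ _}   {⊥′}     eq with () ← proj₁ (pair-injective eq)
formulaCode-injective {φ = ∀′ _}   {_ ⇒′ _} eq with () ← proj₁ (pair-injective eq)
formulaCode-injective {φ = ∀′ _}   {∀′ _}   eq =
  cong ∀′_ (formulaCode-injective (proj₂ (pair-injective eq)))

-- A formula whose free variables are names from ℕ: variable i is named by the
-- i-th entry of the vector.
Instance : Set
Instance = Σ[ n ∈ ℕ ] Formula n × Vec ℕ n

Instance-countable : Instance ↣ ℕ
Instance-countable = mk↣ injective
  where
  code : Instance → ℕ
  code (n , φ , σ) = pair n (pair (formulaCode φ) (vecCode σ))

  injective : ∀ {s t} → code s ≡ code t → s ≡ t
  injective {m , _} {n , _} eq with refl , eq′ ← pair-injective {m} {c = n} eq =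
    let p , q = pair-injective eq′
    in cong (_ ,_) (cong₂ _,_ (formulaCode-injective p) (vecCode-injective q))

Quantified : Set
Quantified = Σ[ n ∈ ℕ ] Formula (suc n) × Vec ℕ n

Quantified-countable : Quantified ↣ ℕ
Quantified-countable = Instance-countable ↣-∘ mk↣ quantify-injective
  where
  quantify : Quantified → Instance
  quantify (n , φ , σ) = n , ∀′ φ , σ

  quantify-injective : ∀ {s t} → quantify s ≡ quantify t → s ≡ t
  quantify-injective {_ , _ , _} {_ , _ , _} refl = refl

⊥-countable : ⊥ ↣ ℕ
⊥-countable = mk↣ {to = λ ()} λ { {()} }

-- Rasiowa–Sikorski: a descending sequence of conditions meeting countably many dense sets.
module Generic (em : ExcludedMiddle 0ℓ) {C T : Set} (_≼_ : C → C → Set)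
  (≼-refl : ∀ {c} → c ≼ c) (≼-trans : ∀ {c d e} → c ≼ d → d ≼ e → c ≼ e)
  (T-countable : T ↣ ℕ) (D : T → C → Set) (dense : ∀ t c → ∃[ d ] d ≼ c × D t d) (c₀ : C)
  where

  -- Stage `k` serves the task coded by `k`, if any. Injectivity of the coding makes that task
  -- unique, so each task is met right after the stage of its own code.
  step : ℕ → C → C
  step k c with em {Σ[ t ∈ T ] Injection.to T-countable t ≡ k}
  ... | yes (t , _) = proj₁ (dense t c)
  ... | no  _       = c

  step-≼ : ∀ k c → step k c ≼ c
  step-≼ k c with em {Σ[ t ∈ T ] Injection.to T-countable t ≡ k}
  ... | yes (t , _) = proj₁ (proj₂ (dense t c))
  ... | no  _       = ≼-refl

  step-meets : ∀ t c → D t (step (Injection.to T-countable t) c)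
  step-meets t c with em {Σ[ s ∈ T ] Injection.to T-countable s ≡ Injection.to T-countable t}
  ... | yes (s , eq) with refl ← Injection.injective T-countable eq = proj₂ (proj₂ (dense t c))
  ... | no  none     = contradiction (t , refl) none

  chain : ℕ → C
  chain zero    = c₀
  chain (suc k) = step k (chain k)

  chain-descending : ∀ {i j} → i ≤ j → chain j ≼ chain i
  chain-descending = go ∘ ≤⇒≤′
    where
    go : ∀ {i j} → i ≤′ j → chain j ≼ chain i
    go ≤′-refl               = ≼-refl
    go (≤′-step {n = j} i≤j) = ≼-trans (step-≼ j (chain j)) (go i≤j)

  chain-meets : ∀ t → ∃[ k ] D t (chain k)
  chain-meets t = _ , step-meets t (chain (Injection.to T-countable t))

-- Types, isolation and separating formulas.

infix 21 ¬′_
¬′_ : Formula n → Formula n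
¬′ φ = φ ⇒′ ⊥′

⋀′ : List (Formula n) → Formula n
⋀′ []       = ¬′ ⊥′
⋀′ (φ ∷ φs) = ¬′ (φ ⇒′ ¬′ ⋀′ φs)

-- One inclusion suffices: applied to negations, it yields the converse classically.
SameType : (𝒜 : MonounaryAlgebra) → Vec (Carrier 𝒜) n →
           (ℬ : MonounaryAlgebra) → Vec (Carrier ℬ) n → Set
SameType 𝒜 v ℬ w = ∀ φ → Satisfies 𝒜 v φ → Satisfies ℬ w φ

FinitelyManyTypes : MonounaryAlgebra → ℕ → Set
FinitelyManyTypes 𝒜 n =
  Σ[ ts ∈ List (Vec (Carrier 𝒜) n) ] (∀ v → Any (λ t → SameType 𝒜 t 𝒜 v) ts)

Isolated : (𝒜 : MonounaryAlgebra) → Vec (Carrier 𝒜) n → Set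
Isolated 𝒜 v = ∃[ χ ] Satisfies 𝒜 v χ × (∀ u → Satisfies 𝒜 u χ → SameType 𝒜 v 𝒜 u)

Forth : MonounaryAlgebra → MonounaryAlgebra → Set
Forth 𝒜 ℬ = ∀ {n} {v : Vec (Carrier 𝒜) n} {w : Vec (Carrier ℬ) n} → SameType 𝒜 v ℬ w →
            ∀ a → ∃[ b ] SameType 𝒜 (a ∷ v) ℬ (b ∷ w)

module Classical (em : ExcludedMiddle 0ℓ) where

  dne : ¬ ¬ X → X
  dne = decidable-stable em

  module _ {𝒜 : MonounaryAlgebra} {v : Vec (Carrier 𝒜) n} where

    ⋀′-elim : ∀ {φs} → Satisfies 𝒜 v (⋀′ φs) → All (Satisfies 𝒜 v) φs
    ⋀′-elim {[]}     _ = []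
    ⋀′-elim {φ ∷ φs} s = dne (λ ¬φ → s λ p _ → ¬φ p) ∷ ⋀′-elim (dne λ ¬φs → s λ _ → ¬φs)

    ⋀′-intro : ∀ {φs} → All (Satisfies 𝒜 v) φs → Satisfies 𝒜 v (⋀′ φs)
    ⋀′-intro []       = λ ()
    ⋀′-intro (p ∷ ps) = λ f → f p (⋀′-intro ps)

    ∃′-elim : ∀ {φ} → Satisfies 𝒜 v (¬′ (∀′ ¬′ φ)) → ∃[ a ] Satisfies 𝒜 (a ∷ v) φ
    ∃′-elim s = dne λ none → s λ a p → none (a , p)

  SameType-sym : ∀ {v : Vec (Carrier 𝒜) n} {w : Vec (Carrier ℬ) n} →
                 SameType 𝒜 v ℬ w → SameType ℬ w 𝒜 v
  SameType-sym p φ q = dne λ ¬φ → p (¬′ φ) ¬φ q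

  -- Every listed `t` whose type differs from that of `w` satisfies some `φ` that fails at `w`.
  -- Conjoining these `¬′ φ` excludes all such `t` at once.
  separate : ∀ 𝒜 ℬ (w : Vec (Carrier ℬ) n) ts →
             ∃[ ψ ] Satisfies ℬ w ψ × All (λ t → Satisfies 𝒜 t ψ → SameType 𝒜 t ℬ w) ts
  separate 𝒜 ℬ w []       = ¬′ ⊥′ , (λ ()) , []
  separate 𝒜 ℬ w (t ∷ ts)
    with separate 𝒜 ℬ w ts | em {Σ[ φ ∈ _ ] Satisfies 𝒜 t φ × ¬ Satisfies ℬ w φ}
  ... | ψ , w⊨ψ , sep | no  same          = ψ , w⊨ψ , (λ _ φ p → dne λ ¬q → same (φ , p , ¬q)) ∷ sep
  ... | ψ , w⊨ψ , sep | yes (φ , p , ¬q) =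
    ⋀′ (ψ ∷ ¬′ φ ∷ []) , ⋀′-intro {φs = ψ ∷ ¬′ φ ∷ []} (w⊨ψ ∷ ¬q ∷ []) ,
    (λ s → contradiction p (elim₂ s)) ∷ All.map (λ f s → f (elim₁ s)) sep
    where
    elim₁ : ∀ {t} → Satisfies 𝒜 t (⋀′ (ψ ∷ ¬′ φ ∷ [])) → Satisfies 𝒜 t ψ
    elim₁ s = All.head (⋀′-elim {φs = ψ ∷ ¬′ φ ∷ []} s)
    elim₂ : ∀ {t} → Satisfies 𝒜 t (⋀′ (ψ ∷ ¬′ φ ∷ [])) → Satisfies 𝒜 t (¬′ φ)
    elim₂ s = All.head (All.tail (⋀′-elim {φs = ψ ∷ ¬′ φ ∷ []} s))

  -- A tuple `u` satisfying `ψ` shares its type with a listed `t`, which then satisfies `ψ` and so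
  -- has the type of `w`. With `ℬ` equal to `𝒜` this isolates types; for another `ℬ` it recognises
  -- types of `ℬ` inside `𝒜`.
  separate-types : ∀ {𝒜} ((ts , _) : FinitelyManyTypes 𝒜 n) ℬ w →
    ∃[ ψ ] Satisfies ℬ w ψ × (∀ u → Satisfies 𝒜 u ψ → SameType ℬ w 𝒜 u)
  separate-types {𝒜 = 𝒜} (ts , covers) ℬ w with ψ , w⊨ψ , sep ← separate 𝒜 ℬ w ts =
    ψ , w⊨ψ , λ u u⊨ψ → go u u⊨ψ (covers u) sep
    where
    go : ∀ u → Satisfies 𝒜 u ψ → ∀ {ts} → Any (λ t → SameType 𝒜 t 𝒜 u) ts →
         All (λ t → Satisfies 𝒜 t ψ → SameType 𝒜 t ℬ w) ts → SameType ℬ w 𝒜 u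
    go u u⊨ψ (here t~u) (f ∷ _) φ = t~u φ ∘ SameType-sym (f (SameType-sym t~u ψ u⊨ψ)) φ
    go u u⊨ψ (there i)  (_ ∷ s)   = go u u⊨ψ i s

  -- Solvability of `χ` passes from `v` to `w`, and so does `∀′ (χ ⇒′ φ)` for each `φ` true at
  -- `a ∷ v`. Any solution over `w` therefore has the whole type.
  isolated⇒forth : (∀ {n} (v : Vec (Carrier 𝒜) n) → Isolated 𝒜 v) → Forth 𝒜 ℬ
  isolated⇒forth {𝒜} isolated {v = v} v~w a with χ , p , iso ← isolated (a ∷ v) =
    let b , q = ∃′-elim {φ = χ} (v~w (¬′ (∀′ ¬′ χ)) λ f → f a p)
    in b , λ φ r → v~w (∀′ (χ ⇒′ φ)) (λ c s → iso (c ∷ v) s φ r) b q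

  -- Isolation is not known in `ℬ`, so `ψ` comes from comparing `b ∷ w` with the finite list of
  -- types of `𝒜`.
  finitelyManyTypes⇒back : (∀ n → FinitelyManyTypes 𝒜 n) → Forth ℬ 𝒜
  finitelyManyTypes⇒back {ℬ = ℬ} finite {n} {w} {v} w~v b
    with ψ , p , sep ← separate-types (finite (suc n)) ℬ (b ∷ w) =
    let a , q = ∃′-elim {φ = ψ} (w~v (¬′ (∀′ ¬′ ψ)) λ f → f b p)
    in a , sep (a ∷ v) q

  -- Back-and-forth between countable algebras.

  module BackAndForth {𝒜 ℬ : MonounaryAlgebra}
    (𝒜-countable : Countable 𝒜) (ℬ-countable : Countable ℬ) (forth : Forth 𝒜 ℬ) (back : Forth ℬ 𝒜) where

    private
      A = Carrier 𝒜
      B = Carrier ℬ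

    PartialIso : Set
    PartialIso = Σ[ n ∈ ℕ ] Σ[ v ∈ Vec A n ] Σ[ w ∈ Vec B n ] SameType 𝒜 v ℬ w

    Maps : PartialIso → A → B → Set
    Maps (n , v , w , _) a b = Σ[ i ∈ Fin n ] lookup v i ≡ a × lookup w i ≡ b

    -- Compared by matched pairs and not by vectors, since a new head shifts every index.
    _≼_ : PartialIso → PartialIso → Set
    c ≼ d = ∀ {a b} → Maps d a b → Maps c a b

    Meets : A ⊎ B → PartialIso → Set
    Meets (inj₁ a) c = ∃[ b ] Maps c a b
    Meets (inj₂ b) c = ∃[ a ] Maps c a b

    extend : ∀ t c → ∃[ d ] d ≼ c × Meets t d
    extend (inj₁ a) (n , v , w , v~w) with b , p ← forth v~w a =
      (suc n , a ∷ v , b ∷ w , p) , (λ (i , q) → suc i , q) , b , zero , refl , refl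
    extend (inj₂ b) (n , v , w , v~w) with a , p ← back (SameType-sym v~w) b =
      (suc n , a ∷ v , b ∷ w , SameType-sym p) , (λ (i , q) → suc i , q) , a , zero , refl , refl

    -- The union of a generic chain is the graph of the isomorphism. The dense sets make it total
    -- and onto; at a stage containing two given pairs, preservation of atomic formulas makes it
    -- functional, injective and homomorphic.
    isomorphism : (c₀ : PartialIso) →
      Σ[ f ∈ 𝒜 ≅ ℬ ] (∀ {a b} → Maps c₀ a b → Inverse.to (proj₁ f) a ≡ b)
    isomorphism c₀ =
      (mk↔ₛ′ to from to∘from from∘to , homomorphic) , λ m → functional (to-graph _) (0 , m)
      where
      open Generic em _≼_ id (λ p q → p ∘ q) (⊎-countable 𝒜-countable ℬ-countable) Meets extend c₀

      Graph : A → B → Set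
      Graph a b = ∃[ k ] Maps (chain k) a b

      to : A → B
      to a = proj₁ (proj₂ (chain-meets (inj₁ a)))

      to-graph : ∀ a → Graph a (to a)
      to-graph a = _ , proj₂ (proj₂ (chain-meets (inj₁ a)))

      from : B → A
      from b = proj₁ (proj₂ (chain-meets (inj₂ b)))

      from-graph : ∀ b → Graph (from b) b
      from-graph b = _ , proj₂ (proj₂ (chain-meets (inj₂ b)))

      common : ∀ {a b a′ b′} → Graph a b → Graph a′ b′ →
               ∃[ k ] Maps (chain k) a b × Maps (chain k) a′ b′
      common (k , p) (l , q) =
        k ⊔ l , chain-descending (m≤m⊔n k l) p , chain-descending (m≤n⊔m k l) q

      functional : ∀ {a b b′} → Graph a b → Graph a b′ → b ≡ b′
      functional p q with k , (i , refl , refl) , (j , e , refl) ← common p q =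
        proj₂ (proj₂ (proj₂ (chain k))) (var i ≈′ var j) (sym e)

      injective : ∀ {a a′ b} → Graph a b → Graph a′ b → a ≡ a′
      injective p q with k , (i , refl , refl) , (j , refl , e) ← common p q =
        SameType-sym (proj₂ (proj₂ (proj₂ (chain k)))) (var i ≈′ var j) (sym e)

      preserves-θ : ∀ {a b b′} → Graph a b → Graph (θ 𝒜 a) b′ → b′ ≡ θ ℬ b
      preserves-θ p q with k , (i , refl , refl) , (j , e , refl) ← common p q =
        sym (proj₂ (proj₂ (proj₂ (chain k))) ((θ· var i) ≈′ var j) (sym e))

      to∘from : ∀ b → to (from b) ≡ b
      to∘from b = functional (to-graph (from b)) (from-graph b)

      from∘to : ∀ a → from (to a) ≡ a
      from∘to a = injective (from-graph (to a)) (to-graph a)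

      homomorphic : ∀ a → to (θ 𝒜 a) ≡ θ ℬ (to a)
      homomorphic a = preserves-θ (to-graph a) (to-graph (θ 𝒜 a))

-- Pigeonhole, iterates of `θ` and isomorphisms.

pigeonhole-cover : ∀ {P : ℕ → X → Set} (xs : List X) → (∀ k → Any (P k) xs) →
  ∃[ i ] ∃[ j ] i < j × ∃[ x ] P i x × P j x
pigeonhole-cover {P = P} xs covers
  with i , j , i<j , eq ← pigeonhole {length xs} ≤-refl (λ k → index (covers (toℕ k))) =
  toℕ i , toℕ j , i<j , lookupₗ xs (index (covers (toℕ i))) , Any.lookup-index (covers (toℕ i)) ,
  subst (λ l → P (toℕ j) (lookupₗ xs l)) (sym eq) (Any.lookup-index (covers (toℕ j)))

power : (𝒜 : MonounaryAlgebra) → ℕ → Carrier 𝒜 → Carrier 𝒜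
power 𝒜 zero    x = x
power 𝒜 (suc k) x = θ 𝒜 (power 𝒜 k x)

power-+ : ∀ 𝒜 k l {x} → power 𝒜 (k + l) x ≡ power 𝒜 k (power 𝒜 l x)
power-+ 𝒜 zero    l = refl
power-+ 𝒜 (suc k) l = cong (θ 𝒜) (power-+ 𝒜 k l)

power-∸ : ∀ 𝒜 {k l x} → l ≤ k → power 𝒜 k x ≡ power 𝒜 (k ∸ l) (power 𝒜 l x)
power-∸ 𝒜 {k} {l} l≤k = trans (cong (λ i → power 𝒜 i _) (sym (m∸n+n≡m l≤k))) (power-+ 𝒜 (k ∸ l) l)

Homomorphic : (𝒜 ℬ : MonounaryAlgebra) → (Carrier 𝒜 → Carrier ℬ) → Set
Homomorphic 𝒜 ℬ g = ∀ x → g (θ 𝒜 x) ≡ θ ℬ (g x)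

power-homomorphic : ∀ {g} → Homomorphic 𝒜 ℬ g → ∀ k {x} → g (power 𝒜 k x) ≡ power ℬ k (g x)
power-homomorphic hom zero    = refl
power-homomorphic {ℬ = ℬ} hom (suc k) = trans (hom _) (cong (θ ℬ) (power-homomorphic hom k))

module _ (f : 𝒜 ≅ ℬ) where
  open Inverse (proj₁ f)

  from-homomorphic : Homomorphic ℬ 𝒜 from
  from-homomorphic y = begin
    from (θ ℬ y)             ≡⟨ cong (from ∘ θ ℬ) (strictlyInverseˡ y) ⟨
    from (θ ℬ (to (from y))) ≡⟨ cong from (proj₂ f (from y)) ⟨
    from (to (θ 𝒜 (from y))) ≡⟨ strictlyInverseʳ (θ 𝒜 (from y)) ⟩
    θ 𝒜 (from y)             ∎
    where open ≡-Reasoning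

  to-⟦⟧ : (t : Term n) (v : Vec (Carrier 𝒜) n) → to (⟦_⟧ 𝒜 t v) ≡ ⟦_⟧ ℬ t (map to v)
  to-⟦⟧ (var i) v = sym (lookup-map i to v)
  to-⟦⟧ (θ· t)  v = trans (proj₂ f _) (cong (θ ℬ) (to-⟦⟧ t v))

  -- Proved together with its converse because an implication uses the opposite direction on its
  -- antecedent.
  ≅⇒SameType : (v : Vec (Carrier 𝒜) n) → SameType 𝒜 v ℬ (map to v)
  ≅⇐SameType : (v : Vec (Carrier 𝒜) n) → SameType ℬ (map to v) 𝒜 v
  ≅⇒SameType v (s ≈′ t) p = trans (sym (to-⟦⟧ s v)) (trans (cong to p) (to-⟦⟧ t v))
  ≅⇒SameType v ⊥′       p = p
  ≅⇒SameType v (φ ⇒′ ψ) p = ≅⇒SameType v ψ ∘ p ∘ ≅⇐SameType v φ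
  ≅⇒SameType v (∀′ φ)   p b =
    subst (λ c → Satisfies ℬ (c ∷ map to v) φ) (strictlyInverseˡ b)
      (≅⇒SameType (from b ∷ v) φ (p (from b)))
  ≅⇐SameType v (s ≈′ t) p =
    Injection.injective (↔⇒↣ (proj₁ f))
      (trans (to-⟦⟧ s v) (trans p (sym (to-⟦⟧ t v))))
  ≅⇐SameType v ⊥′       p = p
  ≅⇐SameType v (φ ⇒′ ψ) p = ≅⇐SameType v ψ ∘ p ∘ ≅⇒SameType v φ
  ≅⇐SameType v (∀′ φ)   p a = ≅⇐SameType (a ∷ v) φ (p (to a))

≅-sym : 𝒜 ≅ ℬ → ℬ ≅ 𝒜
≅-sym {𝒜} {ℬ} f = ↔-sym (proj₁ f) , from-homomorphic {𝒜} {ℬ} f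

infixr 9 _∘≅_
_∘≅_ : ℬ ≅ 𝒞 → 𝒜 ≅ ℬ → 𝒜 ≅ 𝒞
(g , g-hom) ∘≅ (f , f-hom) = g ↔-∘ f , λ x → trans (cong (Inverse.to g) (f-hom x)) (g-hom _)

id≅ : 𝒜 ≅ 𝒜
id≅ = ↔-id _ , λ _ → refl

-- Exchanging two components outside a closed set.

module Outside (em : ExcludedMiddle 0ℓ) (𝒜 : MonounaryAlgebra) (S : Carrier 𝒜 → Set)
  (S-closed : ∀ {x} → S x → S (θ 𝒜 x)) where

  private
    A = Carrier 𝒜

  -- The connected component of b in the partial algebra A ∖ S.
  Near : A → A → Set
  Near b x = ∃[ i ] ∃[ j ] power 𝒜 i x ≡ power 𝒜 j b × ¬ S (power 𝒜 j b)

  power-closed : ∀ k {x} → S x → S (power 𝒜 k x)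
  power-closed zero    s = s
  power-closed (suc k) s = S-closed (power-closed k s)

  near-outside : ∀ {b x} → Near b x → ¬ S x
  near-outside (i , j , eq , ∉S) s = ∉S (subst S eq (power-closed i s))

  near-sym : ∀ {b x} → Near b x → Near x b
  near-sym (i , j , eq , ∉S) = j , i , sym eq , ∉S ∘ subst S eq

  -- Both meeting points lie on the forward orbit of `c`. The farther one is outside `S` and lies on
  -- the forward orbits of both `b` and `x`.
  near-trans : ∀ {b c x} → Near b c → Near c x → Near b x
  near-trans {b} {c} {x} (i , j , eq , ∉S) (k , l , eq′ , ∉S′) with ≤-total i l
  ... | inj₁ i≤l = k , l ∸ i + j , e , subst (¬_ ∘ S) (trans (sym eq′) e) ∉S′
    where
    open ≡-Reasoning
    e = begin
      power 𝒜 k x                      ≡⟨ eq′ ⟩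
      power 𝒜 l c                      ≡⟨ power-∸ 𝒜 i≤l ⟩
      power 𝒜 (l ∸ i) (power 𝒜 i c)    ≡⟨ cong (power 𝒜 (l ∸ i)) eq ⟩
      power 𝒜 (l ∸ i) (power 𝒜 j b)    ≡⟨ power-+ 𝒜 (l ∸ i) j ⟨
      power 𝒜 (l ∸ i + j) b            ∎
  ... | inj₂ l≤i = i ∸ l + k , j , e , ∉S
    where
    open ≡-Reasoning
    e = begin
      power 𝒜 (i ∸ l + k) x            ≡⟨ power-+ 𝒜 (i ∸ l) k ⟩
      power 𝒜 (i ∸ l) (power 𝒜 k x)    ≡⟨ cong (power 𝒜 (i ∸ l)) eq′ ⟩
      power 𝒜 (i ∸ l) (power 𝒜 l c)    ≡⟨ power-∸ 𝒜 l≤i ⟨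
      power 𝒜 i c                      ≡⟨ eq ⟩
      power 𝒜 j b                      ∎

  -- If `x` is strictly before the meeting point, `θ x` still reaches it. So only a point of the
  -- forward orbit of `b` itself can step into `S`.
  near-θ : ∀ {b x} → Near b x → Near b (θ 𝒜 x) ⊎ ∃[ j ] θ 𝒜 x ≡ power 𝒜 j b × S (power 𝒜 j b)
  near-θ {b} {x} (zero , j , eq , ∉S) with em {S (power 𝒜 (suc j) b)}
  ... | yes ∈S = inj₂ (suc j , cong (θ 𝒜) eq , ∈S)
  ... | no  ∉S′ = inj₁ (zero , suc j , cong (θ 𝒜) eq , ∉S′)
  near-θ {b} {x} (suc i , j , eq , ∉S) = inj₁ (i , j , trans (power-θ i) eq , ∉S)
    where
    power-θ : ∀ i {x} → power 𝒜 i (θ 𝒜 x) ≡ power 𝒜 (suc i) x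
    power-θ zero    = refl
    power-θ (suc i) = cong (θ 𝒜) (power-θ i)

  -- Being near `b`, the point `θ x` is outside `S` and hence joined to `x`. By contraposition, `θ`
  -- never leads from outside the component into it.
  near-θ⁻ : ∀ {b x} → Near b (θ 𝒜 x) → Near b x
  near-θ⁻ {b} {x} p = near-trans p (near-sym (0 , 1 , refl , near-outside p))

  -- The forward orbits of b and b′ enter S at the same time and place, or never.
  EnterAlike : A → A → Set
  EnterAlike b b′ = ∀ j → S (power 𝒜 j b) ⊎ S (power 𝒜 j b′) → power 𝒜 j b ≡ power 𝒜 j b′

  enterAlike-sym : ∀ {b b′} → EnterAlike b b′ → EnterAlike b′ b
  enterAlike-sym e j = sym ∘ e j ∘ swap

  module _ {g : A → A} (g-hom : Homomorphic 𝒜 𝒜 g) {b b′ : A} (gb≡b′ : g b ≡ b′)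
    (alike : EnterAlike b b′) where

    power-image : ∀ j → g (power 𝒜 j b) ≡ power 𝒜 j b′
    power-image j = trans (power-homomorphic {𝒜} {𝒜} g-hom j) (cong (power 𝒜 j) gb≡b′)

    near-image : ∀ {x} → Near b x → Near b′ (g x)
    near-image (i , j , eq , ∉S) =
      i , j , trans (sym (power-homomorphic {𝒜} {𝒜} g-hom i)) (trans (cong g eq) (power-image j)) ,
      λ s → ∉S (subst S (sym (alike j (inj₂ s))) s)

  module Exchange (g g⁻ : A → A) (b b′ : A) where

    -- The order of the cases matters when the components of `b` and `b′` coincide: then `g` moves
    -- all of it, and the inverse, built with both pairs of arguments swapped, moves all of it by
    -- `g⁻`.
    exchange : A → A
    exchange x with em {Near b x} | em {Near b′ x}
    ... | yes _ | _     = g x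
    ... | no  _ | yes _ = g⁻ x
    ... | no  _ | no  _ = x

    exchange-near : ∀ {x} → Near b x → exchange x ≡ g x
    exchange-near {x} p with em {Near b x} | em {Near b′ x}
    ... | yes _  | _ = refl
    ... | no  ¬p | _ = contradiction p ¬p

    exchange-near′ : ∀ {x} → ¬ Near b x → Near b′ x → exchange x ≡ g⁻ x
    exchange-near′ {x} ¬p p′ with em {Near b x} | em {Near b′ x}
    ... | yes p | _      = contradiction p ¬p
    ... | no  _ | yes _  = refl
    ... | no  _ | no ¬p′ = contradiction p′ ¬p′

    exchange-far : ∀ {x} → ¬ Near b x → ¬ Near b′ x → exchange x ≡ x
    exchange-far {x} ¬p ¬p′ with em {Near b x} | em {Near b′ x}
    ... | yes p | _      = contradiction p ¬p
    ... | no  _ | yes p′ = contradiction p′ ¬p′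
    ... | no  _ | no _   = refl

    exchange-inside : ∀ {x} → S x → exchange x ≡ x
    exchange-inside s = exchange-far (λ p → near-outside p s) (λ p → near-outside p s)

    module _ (g-hom : Homomorphic 𝒜 𝒜 g) (g⁻-hom : Homomorphic 𝒜 𝒜 g⁻)
      (gb≡b′ : g b ≡ b′) (g⁻b′≡b : g⁻ b′ ≡ b) (alike : EnterAlike b b′) where

      -- The delicate case is a step from a component into `S`, where `exchange` becomes the
      -- identity. Such a step lands on `θʲ b = θʲ b′`, which `g` and `g⁻` fix as well.
      exchange-homomorphic : Homomorphic 𝒜 𝒜 exchange
      exchange-homomorphic x with em {Near b x} | em {Near b′ x}
      ... | yes p | _ with near-θ p
      ...   | inj₁ q = trans (exchange-near q) (g-hom x)
      ...   | inj₂ (j , eq , ∈S) = begin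
        exchange (θ 𝒜 x) ≡⟨ exchange-inside (subst S (sym eq) ∈S) ⟩
        θ 𝒜 x            ≡⟨ eq ⟩
        power 𝒜 j b      ≡⟨ alike j (inj₁ ∈S) ⟩
        power 𝒜 j b′     ≡⟨ power-image g-hom gb≡b′ alike j ⟨
        g (power 𝒜 j b)  ≡⟨ cong g eq ⟨
        g (θ 𝒜 x)        ≡⟨ g-hom x ⟩
        θ 𝒜 (g x)        ∎
        where open ≡-Reasoning
      exchange-homomorphic x | no ¬p | yes p′ with near-θ p′
      ...   | inj₁ q = trans (exchange-near′ (¬p ∘ near-θ⁻) q) (g⁻-hom x)
      ...   | inj₂ (j , eq , ∈S) = begin
        exchange (θ 𝒜 x)  ≡⟨ exchange-inside (subst S (sym eq) ∈S) ⟩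
        θ 𝒜 x             ≡⟨ eq ⟩
        power 𝒜 j b′      ≡⟨ alike j (inj₂ ∈S) ⟨
        power 𝒜 j b       ≡⟨ power-image g⁻-hom g⁻b′≡b (enterAlike-sym alike) j ⟨
        g⁻ (power 𝒜 j b′) ≡⟨ cong g⁻ eq ⟨
        g⁻ (θ 𝒜 x)        ≡⟨ g⁻-hom x ⟩
        θ 𝒜 (g⁻ x)        ∎
        where open ≡-Reasoning
      exchange-homomorphic x | no ¬p | no ¬p′ = exchange-far (¬p ∘ near-θ⁻) (¬p′ ∘ near-θ⁻)

  exchange-inverse : ∀ {g g⁻ : A → A} {b b′} → Homomorphic 𝒜 𝒜 g → Homomorphic 𝒜 𝒜 g⁻ →
    (∀ x → g⁻ (g x) ≡ x) → (∀ x → g (g⁻ x) ≡ x) → g b ≡ b′ → g⁻ b′ ≡ b → EnterAlike b b′ →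
    ∀ x → Exchange.exchange g⁻ g b′ b (Exchange.exchange g g⁻ b b′ x) ≡ x
  exchange-inverse {g} {g⁻} {b} {b′} g-hom g⁻-hom g⁻g gg⁻ gb g⁻b′ alike x
    with em {Near b x} | em {Near b′ x}
  ... | yes p | _      = trans
    (Exchange.exchange-near g⁻ g b′ b (near-image g-hom gb alike p)) (g⁻g x)
  -- If `g⁻ x` were near `b′` too, the two components would coincide and `x` would be near `b`.
  ... | no ¬p | yes p′ = trans
    (Exchange.exchange-near′ g⁻ g b′ b (λ q → ¬p (near-trans (near-trans r (near-sym q)) p′)) r)
    (gg⁻ x)
    where
    r : Near b (g⁻ x)
    r = near-image g⁻-hom g⁻b′ (enterAlike-sym alike) p′
  ... | no ¬p | no ¬p′ = Exchange.exchange-far g⁻ g b′ b ¬p′ ¬p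

  fixing-automorphism : ∀ {b b′} → SameOrbit 𝒜 b b′ → EnterAlike b b′ →
    Σ[ h ∈ Automorphism 𝒜 ] Inverse.to (proj₁ h) b ≡ b′ ×
      (∀ {x} → S x → Inverse.to (proj₁ h) x ≡ x)
  fixing-automorphism {b} {b′} (f , fb≡b′) alike =
    (mk↔ₛ′ exchange (Exchange.exchange from to b′ b)
      (exchange-inverse from-hom to-hom strictlyInverseˡ strictlyInverseʳ from-b′ fb≡b′
        (enterAlike-sym alike))
      (exchange-inverse to-hom from-hom strictlyInverseʳ strictlyInverseˡ fb≡b′ from-b′ alike)
    , exchange-homomorphic to-hom from-hom fb≡b′ from-b′ alike) , b↦b′ , exchange-inside
    where
    open Inverse (proj₁ f)
    open Exchange to from b b′
    to-hom = proj₂ f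
    from-hom = from-homomorphic {𝒜} {𝒜} f
    from-b′ : from b′ ≡ b
    from-b′ = trans (cong from (sym fb≡b′)) (strictlyInverseʳ b)
    b↦b′ : exchange b ≡ b′
    b↦b′ with em {S b}
    -- Entry at time 0 forces `b` and `b′` to be equal.
    ... | yes ∈S = trans (exchange-inside ∈S) (alike 0 (inj₁ ∈S))
    ... | no  ∉S = trans (exchange-near (0 , 0 , refl , ∉S)) fb≡b′

-- Counting orbits of tuples.

SameTupleOrbit : (𝒜 : MonounaryAlgebra) → Vec (Carrier 𝒜) n → Vec (Carrier 𝒜) n → Set
SameTupleOrbit 𝒜 v w = Σ[ f ∈ Automorphism 𝒜 ] map (Inverse.to (proj₁ f)) v ≡ w

FinitelyManyOrbits : MonounaryAlgebra → ℕ → Set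
FinitelyManyOrbits 𝒜 n =
  Σ[ ts ∈ List (Vec (Carrier 𝒜) n) ] (∀ v → Any (λ t → SameTupleOrbit 𝒜 t v) ts)

finitelyManyOrbits⇒types : FinitelyManyOrbits 𝒜 n → FinitelyManyTypes 𝒜 n
finitelyManyOrbits⇒types {𝒜} (ts , covers) =
  ts , λ v → Any.map (λ where (f , refl) → ≅⇒SameType {𝒜} {𝒜} f _) (covers v)

map-fixes : {f : X → X} (v : Vec X n) → (∀ {x} → x ∈ toList v → f x ≡ x) → map f v ≡ v
map-fixes []      _     = refl
map-fixes (x ∷ v) fixes = cong₂ _∷_ (fixes (here refl)) (map-fixes v (fixes ∘ there))

-- The empty list is treated apart because a `Subalgebra` must be inhabited.
generated-finite : LocallyFinite 𝒜 → ∀ xs → ∃[ ys ] (∀ {x} → ⟨_⟩ 𝒜 xs x → x ∈ ys)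
generated-finite         _  []       = [] , λ p → ⊥-elim (empty p)
  where
  empty : ∀ {x} → ¬ ⟨_⟩ 𝒜 [] x
  empty (apply p) = empty p
generated-finite {𝒜 = 𝒜} lf (x ∷ xs) = lf S (x ∷ xs , id , id)
  where
  S : Subalgebra 𝒜
  S = record { Member = ⟨_⟩ 𝒜 (x ∷ xs) ; inhabited = x , generator (here refl) ; closed = apply }

power-generated : ∀ k {x} → ⟨_⟩ 𝒜 (x ∷ []) (power 𝒜 k x)
power-generated zero    = generator (here refl)
power-generated (suc k) = apply (power-generated k)

eventually-periodic : LocallyFinite 𝒜 → ∀ x → ∃[ i ] ∃[ j ] i < j × power 𝒜 i x ≡ power 𝒜 j x
eventually-periodic {𝒜} lf x =
  let ys , finite = generated-finite lf (x ∷ [])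
      i , j , i<j , y , p , q =
        pigeonhole-cover {P = λ k y → power 𝒜 k x ≡ y} ys (λ k → finite (power-generated k))
  in i , j , i<j , trans p (sym q)

module Counting (em : ExcludedMiddle 0ℓ) where

  least : {P : ℕ → Set} → ∃[ k ] P k → ∃[ k ] P k × (∀ {j} → j < k → ¬ P j)
  least {P} (k , p) = <-rec (λ k → P k → Least) go k p
    where
    Least = ∃[ k ] P k × (∀ {j} → j < k → ¬ P j)
    go : ∀ k → (∀ {j} → j < k → P j → Least) → P k → Least
    go k rec p with em {∃[ j ] j < k × P j}
    ... | yes (j , j<k , q) = rec j<k q
    ... | no  none          = k , p , λ j<k q → none (_ , j<k , q)

  -- Turns finitely many codes into finitely many elements, by choosing one element for each code
  -- that some element has.
  representatives : (D : X → Y → Set) (cs : List Y) →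
    Σ[ xs ∈ List X ] (∀ {x} → Any (D x) cs → Any (λ x′ → ∃[ c ] D x c × D x′ c) xs)
  representatives D []       = [] , λ ()
  representatives D (c ∷ cs) with representatives D cs | em {∃[ x ] D x c}
  ... | xs , rep | yes (x′ , d′) = x′ ∷ xs , λ where
    (here d)  → here (c , d , d′)
    (there i) → there (rep i)
  ... | xs , rep | no none = xs , λ where
    (here d)  → contradiction (_ , d) none
    (there i) → rep i

  module _ {𝒜 : MonounaryAlgebra} (lf : LocallyFinite 𝒜) (fin : FinitelyMany1Orbits 𝒜) where

    private
      A = Carrier 𝒜

    -- Not the minimal period but an index at which the forward orbit repeats an earlier point; it
    -- serves to bound entry times.
    period : A → ℕ
    period x = proj₁ (proj₂ (eventually-periodic lf x))

    power-earlier : ∀ {x i N} → i < N → power 𝒜 i x ≡ power 𝒜 N x →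
                    ∀ {k} → N ≤ k → ∃[ j ] j < k × power 𝒜 j x ≡ power 𝒜 k x
    power-earlier {i = i} {N} i<N eq {k} N≤k =
      k ∸ N + i , <k , trans (power-+ 𝒜 (k ∸ N) i)
        (trans (cong (power 𝒜 (k ∸ N)) eq) (sym (power-∸ 𝒜 N≤k)))
      where
      open ≤-Reasoning
      <k : k ∸ N + i < k
      <k = begin-strict
        k ∸ N + i <⟨ +-monoʳ-< (k ∸ N) i<N ⟩
        k ∸ N + N ≡⟨ m∸n+n≡m N≤k ⟩
        k         ∎

    module _ {S : A → Set} (S-closed : ∀ {x} → S x → S (θ 𝒜 x))
      {ys : List A} (S⊆ys : ∀ {x} → S x → x ∈ ys) where

      open Outside em 𝒜 S S-closed

      -- The code `nothing` stands for never entering `S`, and `just (k , s)` for first entering it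
      -- at time `k` in `s`.
      Entry : A → Maybe (ℕ × A) → Set
      Entry b nothing        = ∀ j → ¬ S (power 𝒜 j b)
      Entry b (just (k , s)) = power 𝒜 k b ≡ s × (∀ {j} → j < k → ¬ S (power 𝒜 j b))

      entry⇒alike : ∀ {b b′} e → Entry b e → Entry b′ e → EnterAlike b b′
      entry⇒alike nothing  p q j = λ where
        (inj₁ s) → contradiction s (p j)
        (inj₂ s) → contradiction s (q j)
      entry⇒alike {b} {b′} (just (k , s)) (p , p′) (q , q′) j ∈S = begin
        power 𝒜 j b                    ≡⟨ power-∸ 𝒜 k≤j ⟩
        power 𝒜 (j ∸ k) (power 𝒜 k b)  ≡⟨ cong (power 𝒜 (j ∸ k)) (trans p (sym q)) ⟩
        power 𝒜 (j ∸ k) (power 𝒜 k b′) ≡⟨ power-∸ 𝒜 k≤j ⟨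
        power 𝒜 j b′                   ∎
        where
        open ≡-Reasoning
        k≤j : k ≤ j
        k≤j = ≮⇒≥ λ j<k → [_,_] (p′ j<k) (q′ j<k) ∈S

      Code : A → A × Maybe (ℕ × A) → Set
      Code b (r , e) = SameOrbit 𝒜 r b × Entry b e

      entries : A → List (Maybe (ℕ × A))
      entries r = nothing ∷ mapₗ just (cartesianProduct (upTo (period r)) ys)

      codes : List (A × Maybe (ℕ × A))
      codes = concatMap (λ r → mapₗ (r ,_) (entries r)) (proj₁ fin)

      coded : ∀ b → Any (Code b) codes
      coded b = Any.concatMap⁺ _ (Any.map code (proj₂ fin b))
        where
        code : ∀ {r} → SameOrbit 𝒜 r b → Any (Code b) (mapₗ (r ,_) (entries r))
        code {r} (f , refl) with em {∃[ k ] S (power 𝒜 k b)}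
        ... | no  never = here ((f , refl) , λ j s → never (j , s))
        ... | yes enters with k , s , first ← least enters =
          there (lose (∈-map⁺ (r ,_) (∈-map⁺ just (∈-cartesianProduct⁺ (∈-upTo⁺ k<N) (S⊆ys s))))
                      ((f , refl) , refl , first))
          where
          open Inverse (proj₁ f)
          -- A first entry at or after `period r` would repeat an earlier point, since `f` carries
          -- the repetition from `r` to `b`. One bound thus serves the whole 1-orbit.
          k<N : k < period r
          k<N = ≰⇒> λ N≤k →
            let _ , _ , i<N , eq′ = eventually-periodic lf r
                j , j<k , eq = power-earlier i<N eq′ N≤k
            in first j<k (subst S (begin
              power 𝒜 k (to r) ≡⟨ power-homomorphic {𝒜} {𝒜} (proj₂ f) k ⟨
              to (power 𝒜 k r) ≡⟨ cong to eq ⟨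
              to (power 𝒜 j r) ≡⟨ power-homomorphic {𝒜} {𝒜} (proj₂ f) j ⟩
              power 𝒜 j (to r) ∎) s)
            where open ≡-Reasoning

      FixingOrbit : A → A → Set
      FixingOrbit b b′ = Σ[ h ∈ Automorphism 𝒜 ]
        Inverse.to (proj₁ h) b ≡ b′ × (∀ {x} → S x → Inverse.to (proj₁ h) x ≡ x)

      -- Elements with a common code lie in the 1-orbit of the same `r` and enter `S` alike, so an
      -- exchange fixing `S` joins them.
      finitelyManyFixingOrbits : Σ[ bs ∈ List A ] (∀ b → Any (λ b′ → FixingOrbit b′ b) bs)
      finitelyManyFixingOrbits with bs , rep ← representatives Code codes = bs , λ b →
        Any.map (λ where
          ((r , e) , ((f , refl) , p) , ((f′ , refl) , p′)) → fixing-automorphism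
            (_∘≅_ {𝒜} {𝒜} {𝒜} f (≅-sym {𝒜} {𝒜} f′) ,
              cong (Inverse.to (proj₁ f)) (Inverse.strictlyInverseʳ (proj₁ f′) r))
            (entry⇒alike e p′ p))
          (rep (coded b))

    -- Induction on `n`: over each representative `t`, the new coordinate matters only up to
    -- automorphisms fixing the finite subalgebra generated by `t`.
    finitelyManyOrbits : ∀ n → FinitelyManyOrbits 𝒜 n
    finitelyManyOrbits zero    = [] ∷ [] , λ where [] → here (id≅ {𝒜} , refl)
    finitelyManyOrbits (suc n) with ts , covers ← finitelyManyOrbits n =
      concatMap extended ts , cover
      where
      extensions : (t : Vec A n) → _
      extensions t = finitelyManyFixingOrbits {S = ⟨_⟩ 𝒜 (toList t)} apply
        (proj₂ (generated-finite lf (toList t)))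

      extended : Vec A n → List (Vec A (suc n))
      extended t = mapₗ (_∷ t) (proj₁ (extensions t))

      cover : ∀ v → Any (λ t → SameTupleOrbit 𝒜 t v) (concatMap extended ts)
      cover (b ∷ v) = Any.concatMap⁺ _ (Any.map extend (covers v))
        where
        extend : ∀ {t} → SameTupleOrbit 𝒜 t v →
                 Any (λ t → SameTupleOrbit 𝒜 t (b ∷ v)) (extended t)
        -- `h` takes a representative `b′` to `from b` and fixes `t`, so `f` after `h` takes
        -- `b′ ∷ t` to `b ∷ v`.
        extend {t} (f , refl) = Any.map⁺ (Any.map (λ where
          (h , hb′≡ , fixes) → _∘≅_ {𝒜} {𝒜} {𝒜} f h , cong₂ _∷_
            (trans (cong to hb′≡) (strictlyInverseˡ b))
            (trans (map-∘ to (Inverse.to (proj₁ h)) t)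
              (cong (map to) (map-fixes t (fixes ∘ generator)))))
          (proj₂ (extensions t) (from b)))
          where open Inverse (proj₁ f)

-- Renaming of variables and definability of projections.

rename-term : Vec (Fin k) n → Term n → Term k
rename-term σ (var i) = var (lookup σ i)
rename-term σ (θ· t)  = θ· rename-term σ t

rename : Vec (Fin k) n → Formula n → Formula k
rename σ (s ≈′ t) = rename-term σ s ≈′ rename-term σ t
rename σ ⊥′       = ⊥′
rename σ (φ ⇒′ ψ) = rename σ φ ⇒′ rename σ ψ
rename σ (∀′ φ)   = ∀′ rename (zero ∷ map suc σ) φ

∃^ : ∀ k → Formula (k + n) → Formula n
∃^ zero    φ = φ
∃^ (suc k) φ = ∃^ k (¬′ (∀′ ¬′ φ))

equations : Vec (Fin k) n → Vec (Fin k) n → List (Formula k)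
equations []      []      = []
equations (i ∷ σ) (j ∷ τ) = (var i ≈′ var j) ∷ equations σ τ

module Instances (𝒜 : MonounaryAlgebra) where

  private
    A = Carrier 𝒜

  ⟦rename-term⟧ : ∀ (σ : Vec (Fin k) n) u t → ⟦_⟧ 𝒜 (rename-term σ t) u ≡ ⟦_⟧ 𝒜 t (map (lookup u) σ)
  ⟦rename-term⟧ σ u (var i) = sym (lookup-map i (lookup u) σ)
  ⟦rename-term⟧ σ u (θ· t)  = cong (θ 𝒜) (⟦rename-term⟧ σ u t)

  Satisfies-rename : ∀ (σ : Vec (Fin k) n) u φ {v} → map (lookup u) σ ≡ v →
                     Satisfies 𝒜 u (rename σ φ) ⇔ Satisfies 𝒜 v φ
  Satisfies-rename σ u (s ≈′ t) refl = mk⇔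
    (λ p → trans (sym (⟦rename-term⟧ σ u s)) (trans p (⟦rename-term⟧ σ u t)))
    (λ p → trans (⟦rename-term⟧ σ u s) (trans p (sym (⟦rename-term⟧ σ u t))))
  Satisfies-rename σ u ⊥′       eq = mk⇔ id id
  Satisfies-rename σ u (φ ⇒′ ψ) eq =
    let p = Satisfies-rename σ u φ eq
        q = Satisfies-rename σ u ψ eq
    in mk⇔ (λ f → Equivalence.to q ∘ f ∘ Equivalence.from p)
           (λ f → Equivalence.from q ∘ f ∘ Equivalence.to p)
  Satisfies-rename σ u (∀′ φ)   {v} eq = mk⇔
    (λ p a → Equivalence.to (Satisfies-rename (zero ∷ map suc σ) (a ∷ u) φ (eq′ a)) (p a))
    (λ p a → Equivalence.from (Satisfies-rename (zero ∷ map suc σ) (a ∷ u) φ (eq′ a)) (p a))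
    where
    eq′ : ∀ a → map (lookup (a ∷ u)) (zero ∷ map suc σ) ≡ a ∷ v
    eq′ a = cong (a ∷_) (trans (sym (map-∘ (lookup (a ∷ u)) suc σ)) eq)

  equations-elim : ∀ {u : Vec A k} (σ τ : Vec (Fin k) n) →
    All (Satisfies 𝒜 u) (equations σ τ) → map (lookup u) σ ≡ map (lookup u) τ
  equations-elim []      []      _        = refl
  equations-elim (_ ∷ σ) (_ ∷ τ) (p ∷ ps) = cong₂ _∷_ p (equations-elim σ τ ps)

  equations-intro : ∀ {u : Vec A k} (σ τ : Vec (Fin k) n) →
    map (lookup u) σ ≡ map (lookup u) τ → All (Satisfies 𝒜 u) (equations σ τ)
  equations-intro []      []      _  = []
  equations-intro (_ ∷ σ) (_ ∷ τ) eq =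
    let p , q = ∷-injective eq in p ∷ equations-intro σ τ q

  _⊩_ : (ℕ → A) → Instance → Set
  ρ ⊩ (n , φ , σ) = Satisfies 𝒜 (map ρ σ) φ

  _⊩*_ : (ℕ → A) → List Instance → Set
  ρ ⊩* L = All (ρ ⊩_) L

  Agree : ℕ → (ℕ → A) → (ℕ → A) → Set
  Agree N ρ ρ′ = ∀ {i} → i < N → ρ i ≡ ρ′ i

  -- A strict bound, so that the bound itself is a fresh name.
  names : Vec ℕ n → ℕ
  names []      = 0
  names (i ∷ σ) = suc i ⊔ names σ

  names* : List Instance → ℕ
  names* []                = 0
  names* ((_ , _ , σ) ∷ L) = names σ ⊔ names* L

  agree-map : ∀ (σ : Vec ℕ n) {ρ ρ′} → Agree (names σ) ρ ρ′ → map ρ σ ≡ map ρ′ σ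
  agree-map []      _     = refl
  agree-map (i ∷ σ) agree =
    cong₂ _∷_ (agree (m≤m⊔n (suc i) (names σ)))
      (agree-map σ λ j<N → agree (≤-trans j<N (m≤n⊔m (suc i) (names σ))))

  agree-⊩* : ∀ L {ρ ρ′} → Agree (names* L) ρ ρ′ → ρ ⊩* L → ρ′ ⊩* L
  agree-⊩* []                _     []       = []
  agree-⊩* ((_ , φ , σ) ∷ L) agree (p ∷ ps) =
    subst (λ v → Satisfies 𝒜 v φ)
      (agree-map σ (λ i<N → agree (≤-trans i<N (m≤m⊔n (names σ) (names* L))))) p ∷
    agree-⊩* L (λ i<N → agree (≤-trans i<N (m≤n⊔m (names σ) (names* L)))) ps

  module Projection (em : ExcludedMiddle 0ℓ) where
    open Classical em

    ∃^-elim : ∀ k {φ : Formula (k + n)} {v} → Satisfies 𝒜 v (∃^ k φ) →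
              Σ[ z ∈ Vec A k ] Satisfies 𝒜 (z ++ v) φ
    ∃^-elim zero    p = [] , p
    ∃^-elim (suc k) {φ} p with z , q ← ∃^-elim k p =
      let a , r = ∃′-elim {φ = φ} q in a ∷ z , r

    ∃^-intro : ∀ {k} {φ : Formula (k + n)} {v} (z : Vec A k) →
               Satisfies 𝒜 (z ++ v) φ → Satisfies 𝒜 v (∃^ k φ)
    ∃^-intro []      p = p
    ∃^-intro (a ∷ z) p = ∃^-intro z λ f → f a p

    -- Only names below some `N` occur, so the existence of an assignment amounts to `N` existential
    -- quantifiers. The equations tie the values of the names `ı` to the free variables.
    projection-definable : ∀ L (ı : Vec ℕ n) → ∃[ χ ]
      (∀ {v} → Satisfies 𝒜 v χ → ∃[ ρ ] ρ ⊩* L × map ρ ı ≡ v) ×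
      (∀ {ρ} → ρ ⊩* L → Satisfies 𝒜 (map ρ ı) χ)
    projection-definable {n} L ı = ∃^ N (⋀′ (matrix L)) , elim , intro
      where
      -- The successor keeps `N` positive, so that `mod` sends every name into `Fin N`; the names
      -- that occur are left unchanged.
      N = suc (names ı ⊔ names* L)

      name : ℕ → Fin (N + n)
      name i = (i mod N) ↑ˡ n

      free : Vec (Fin (N + n)) n
      free = map (N ↑ʳ_) (allFin n)

      matrix : List Instance → List (Formula (N + n))
      matrix L = equations (map name ı) free ++ₗ mapₗ (λ (_ , φ , σ) → rename (map name σ) φ) L

      assign : Vec A N → ℕ → A
      assign z i = lookup z (i mod N)

      map-name : ∀ z v (σ : Vec ℕ m) → map (lookup (z ++ v)) (map name σ) ≡ map (assign z) σ
      map-name z v σ = trans (sym (map-∘ _ name σ)) (map-cong (λ i → lookup-++ˡ z v (i mod N)) σ)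

      map-free : ∀ (z : Vec A N) v → map (lookup (z ++ v)) free ≡ v
      map-free z v = trans (sym (map-∘ _ (N ↑ʳ_) (allFin n)))
        (trans (map-cong (lookup-++ʳ z v) (allFin n)) (map-lookup-allFin v))

      elim : ∀ {v} → Satisfies 𝒜 v (∃^ N (⋀′ (matrix L))) → ∃[ ρ ] ρ ⊩* L × map ρ ı ≡ v
      elim {v} p with z , q ← ∃^-elim N p =
        let eqs , ps = All.++⁻ (equations (map name ı) free) (⋀′-elim {φs = matrix L} q)
        in assign z ,
           All.map
             (λ {(_ , φ , σ)} →
               Equivalence.to (Satisfies-rename (map name σ) (z ++ v) φ (map-name z v σ)))
             (All.map⁻ ps) ,
           trans (sym (map-name z v ı)) (trans (equations-elim (map name ı) free eqs) (map-free z v))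

      intro : ∀ {ρ} → ρ ⊩* L → Satisfies 𝒜 (map ρ ı) (∃^ N (⋀′ (matrix L)))
      intro {ρ} ps = ∃^-intro z (⋀′-intro (All.++⁺
        (equations-intro (map name ı) free (begin
          map (lookup (z ++ map ρ ı)) (map name ı) ≡⟨ map-name z _ ı ⟩
          map (assign z) ı                         ≡⟨ agree-map ı (below (m≤m⊔n (names ı) (names* L))) ⟨
          map ρ ı                                  ≡⟨ map-free z _ ⟨
          map (lookup (z ++ map ρ ı)) free         ∎))
        (All.map⁺ (All.map
          (λ {(_ , φ , σ)} →
            Equivalence.from (Satisfies-rename (map name σ) (z ++ map ρ ı) φ (map-name z _ σ)))
          (agree-⊩* L (below (m≤n⊔m (names ı) (names* L))) ps)))))
        where
        z : Vec A N
        z = tabulate (ρ ∘ toℕ)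

        open ≡-Reasoning

        agree : Agree (names ı ⊔ names* L) ρ (assign z)
        agree {i} i<M = begin
          ρ i                ≡⟨ cong ρ (m<n⇒m%n≡m (m≤n⇒m≤1+n i<M)) ⟨
          ρ (i % N)          ≡⟨ cong ρ (toℕ-fromℕ< _) ⟨
          ρ (toℕ (i mod N))  ≡⟨ lookup∘tabulate (ρ ∘ toℕ) (i mod N) ⟨
          assign z i         ∎

        below : ∀ {M} → M ≤ names ı ⊔ names* L → Agree M ρ (assign z)
        below M≤ i<M = agree (≤-trans i<M M≤)

    -- The isolating formula defines the projection of `L` to `ı`. It holds at `v` because `ρ₀`
    -- realises the type of `v` at `ı`.
    implied-type⇒isolated : ∀ {L} {v : Vec A n} ı → ∃[ ρ ] ρ ⊩* L →
      (∀ ψ → Satisfies 𝒜 v ψ → ∀ {ρ} → ρ ⊩* L → ρ ⊩ (n , ψ , ı)) → Isolated 𝒜 v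
    implied-type⇒isolated {L = L} ı (ρ₀ , p₀) implied
      with χ , elim , intro ← projection-definable L ı =
      χ , SameType-sym {𝒜 = 𝒜} {ℬ = 𝒜} (λ ψ s → implied ψ s p₀) χ (intro p₀) ,
      λ u u⊨χ ψ s → let ρ , p , eq = elim u⊨χ in subst (λ v → Satisfies 𝒜 v ψ) eq (implied ψ s p)

-- Henkin's construction in which consistency means satisfiability in 𝒜 itself,
-- jointly with each of the constraints Γ k on the assignment of the names.
module Henkin (em : ExcludedMiddle 0ℓ) (𝒜 : MonounaryAlgebra)
  (Γ : ℕ → (ℕ → Carrier 𝒜) → Set) (Γ-antitone : ∀ {k l ρ} → k ≤ l → Γ l ρ → Γ k ρ)
  (N₀ : ℕ) (Γ-local : ∀ {k ρ ρ′} → Instances.Agree 𝒜 N₀ ρ ρ′ → Γ k ρ → Γ k ρ′)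
  (Γ-satisfiable : ∀ k → ∃[ ρ ] Γ k ρ)
  {K : Set} (K-countable : K ↣ ℕ) (Goal : K → List Instance → Set)
  where

  open Classical em
  open Counting em
  open Instances 𝒜

  private
    A = Carrier 𝒜

  -- The assignment may depend on `k`; this is where compactness enters, as no single assignment
  -- need obey all constraints.
  Consistent : List Instance → Set
  Consistent L = ∀ k → ∃[ ρ ] Γ k ρ × ρ ⊩* L

  Forces : List Instance → ((ℕ → A) → Set) → Set
  Forces L P = ∀ {ρ} → ρ ⊩* L → P ρ

  Condition : Set
  Condition = Σ[ L ∈ List Instance ] Consistent L

  _≼_ : Condition → Condition → Set
  (L , _) ≼ (M , _) = ∀ {ρ} → ρ ⊩* L → ρ ⊩* M

  neg : Instance → Instance
  neg (n , φ , σ) = n , ¬′ φ , σ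

  -- Some constraint `l` leaves `h` no assignment together with `L`. An assignment for `L` at
  -- `k ⊔ l` obeys both `l` and `k`, so it refutes `h` and serves at `k`.
  negation-consistent : ∀ {h L} → Consistent L → ¬ Consistent (h ∷ L) → Consistent (neg h ∷ L)
  negation-consistent {h} {L} con ¬con k = dne λ none → ¬con λ l →
    let ρ , γ , p = con (k ⊔ l) in dne λ none′ →
      none (ρ , Γ-antitone (m≤m⊔n k l) γ , (λ q → none′ (ρ , Γ-antitone (m≤n⊔m k l) γ , q ∷ p)) ∷ p)

  update : (ℕ → A) → ℕ → A → ℕ → A
  update ρ i a j with i ≟ j
  ... | yes _ = a
  ... | no  _ = ρ j

  update-same : ∀ ρ i {a} → update ρ i a i ≡ a
  update-same ρ i with i ≟ i
  ... | yes _   = refl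
  ... | no  i≢i = contradiction refl i≢i

  update-agrees : ∀ ρ i {a} → Agree i ρ (update ρ i a)
  update-agrees ρ i {_} {j} j<i with i ≟ j
  ... | yes refl = contradiction refl (<⇒≢ j<i)
  ... | no  _    = refl

  witness-consistent : ∀ {n} φ (σ : Vec ℕ n) {L} → Consistent ((n , ¬′ (∀′ φ) , σ) ∷ L) →
                       ∃[ i ] Consistent ((suc n , ¬′ φ , i ∷ σ) ∷ L)
  witness-consistent {n} φ σ {L} con = i , consistent
    where
    -- A fresh name: changing its value disturbs neither the constraints nor `σ` nor `L`.
    i = N₀ ⊔ (names σ ⊔ names* L)

    consistent : Consistent ((suc n , ¬′ φ , i ∷ σ) ∷ L)
    consistent k with ρ , γ , p ∷ ps ← con k =
      let a , ¬q = dne {X = ∃[ a ] ¬ Satisfies 𝒜 (a ∷ map ρ σ) φ}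
                     (λ none → p λ a → dne λ ¬q → none (a , ¬q))
          agree = update-agrees ρ i {a}
      in update ρ i a ,
         Γ-local (λ j< → agree (≤-trans j< (m≤m⊔n N₀ _))) γ ,
         subst (λ v → ¬ Satisfies 𝒜 v φ)
           (cong₂ _∷_ (sym (update-same ρ i))
             (agree-map σ λ j< → agree (≤-trans j< (≤-trans (m≤m⊔n (names σ) _) (m≤n⊔m N₀ _))))) ¬q ∷
         agree-⊩* L (λ j< → agree (≤-trans j< (≤-trans (m≤n⊔m (names σ) _) (m≤n⊔m N₀ _)))) ps

  Task : Set
  Task = Instance ⊎ Quantified ⊎ K

  Meets : Task → Condition → Set
  Meets (inj₁ h) (L , _) = Forces L (_⊩ h) ⊎ Forces L (_⊩ neg h)
  Meets (inj₂ (inj₁ (n , φ , σ))) (L , _) =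
    Forces L (_⊩ (n , ∀′ φ , σ)) ⊎ ∃[ i ] Forces L (_⊩ (suc n , ¬′ φ , i ∷ σ))
  Meets (inj₂ (inj₂ k)) (L , _) = Goal k L

  module Limit
    (goal-dense : ∀ k {L} → Consistent L → ∃[ h ] Consistent (h ∷ L) × Goal k (h ∷ L))
    where

    meet : ∀ t c → ∃[ d ] d ≼ c × Meets t d
    meet (inj₁ h) (L , con) with em {Consistent (h ∷ L)}
    ... | yes p = (h ∷ L , p) , All.tail , inj₁ All.head
    ... | no ¬p = (neg h ∷ L , negation-consistent con ¬p) , All.tail , inj₂ All.head
    meet (inj₂ (inj₁ (n , φ , σ))) (L , con) with em {Consistent ((n , ∀′ φ , σ) ∷ L)}
    ... | yes p = (_ , p) , All.tail , inj₁ All.head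
    ... | no ¬p = let i , q = witness-consistent φ σ (negation-consistent con ¬p)
                  in (_ , q) , All.tail , inj₂ (i , All.head)
    meet (inj₂ (inj₂ k)) (L , con) = let h , p , g = goal-dense k con in (h ∷ L , p) , All.tail , g

    unconstrained : Condition
    unconstrained = [] , λ k → let ρ , γ = Γ-satisfiable k in ρ , γ , []

    open Generic em _≼_ id (λ p q → q ∘ p)
      (⊎-countable Instance-countable (⊎-countable Quantified-countable K-countable)) Meets meet
      unconstrained

    stage : ℕ → List Instance
    stage k = proj₁ (chain k)

    -- Consequence of the limit theory: what one stage forces, all later stages force.
    Eventually : ((ℕ → A) → Set) → Set
    Eventually P = ∃[ k ] Forces (stage k) P

    private variable
      P Q : (ℕ → A) → Set

    always : (∀ ρ → P ρ) → Eventually P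
    always p = 0 , λ _ → p _

    eventually-map : (∀ {ρ} → P ρ → Q ρ) → Eventually P → Eventually Q
    eventually-map f (k , p) = k , f ∘ p

    eventually-zip : ∀ {R : (ℕ → A) → Set} → (∀ {ρ} → P ρ → Q ρ → R ρ) →
                     Eventually P → Eventually Q → Eventually R
    eventually-zip f (k , p) (l , q) = k ⊔ l , λ r →
      f (p (chain-descending (m≤m⊔n k l) r)) (q (chain-descending (m≤n⊔m k l) r))

    eventually-satisfiable : Eventually P → ∀ k → ∃[ ρ ] Γ k ρ × P ρ
    eventually-satisfiable (l , p) k = let ρ , γ , r = proj₂ (chain l) k in ρ , γ , p r

    eventually-decided : ∀ h → Eventually (_⊩ h) ⊎ Eventually (_⊩ neg h)
    eventually-decided h with chain-meets (inj₁ h)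
    ... | k , inj₁ p = inj₁ (k , p)
    ... | k , inj₂ p = inj₂ (k , p)

    eventually-witnessed : ∀ {n} φ (σ : Vec ℕ n) → Eventually (_⊩ (n , ∀′ φ , σ)) ⊎
                           ∃[ i ] Eventually (_⊩ (suc n , ¬′ φ , i ∷ σ))
    eventually-witnessed φ σ with chain-meets (inj₂ (inj₁ (_ , φ , σ)))
    ... | k , inj₁ p       = inj₁ (k , p)
    ... | k , inj₂ (i , p) = inj₂ (i , k , p)

    goal-met : ∀ k → ∃[ l ] Goal k (stage l)
    goal-met k = chain-meets (inj₂ (inj₂ k))

    representative : ∀ i → ∃[ j ] Eventually (λ ρ → ρ i ≡ ρ j) ×
                     (∀ {k} → k < j → ¬ Eventually (λ ρ → ρ i ≡ ρ k))
    representative i = least (i , always λ _ → refl)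

    rep : ℕ → ℕ
    rep i = proj₁ (representative i)

    rep-equal : ∀ i → Eventually (λ ρ → ρ i ≡ ρ (rep i))
    rep-equal i = proj₁ (proj₂ (representative i))

    rep-cong : ∀ {i j} → Eventually (λ ρ → ρ i ≡ ρ j) → rep i ≡ rep j
    rep-cong {i} {j} p = ≤-antisym
      (≮⇒≥ λ lt → proj₂ (proj₂ (representative i)) lt (eventually-zip trans p (rep-equal j)))
      (≮⇒≥ λ lt → proj₂ (proj₂ (representative j)) lt (eventually-zip (trans ∘ sym) p (rep-equal i)))

    -- The names modulo eventual equality, as least representatives.
    B : Set
    B = Σ[ i ∈ ℕ ] rep i ≡ i

    [_]ᵣ : ℕ → B
    [ i ]ᵣ = rep i , sym (rep-cong (rep-equal i))

    B-≡ : ∀ {b c : B} → proj₁ b ≡ proj₁ c → b ≡ c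
    B-≡ {_ , p} {_ , q} refl = cong (_ ,_) (≡-irrelevant p q)

    successor : ∀ i → ∃[ j ] Eventually (λ ρ → ρ j ≡ θ 𝒜 (ρ i))
    -- The universal formula says that no `y` equals `θ x`. It fails under every assignment, so a
    -- Henkin witness against it names `θ x`.
    successor i with eventually-witnessed (¬′ (var zero ≈′ (θ· var (suc zero)))) (i ∷ [])
    ... | inj₁ p       =
      let ρ , _ , q = eventually-satisfiable p 0 in contradiction refl (q (θ 𝒜 (ρ i)))
    ... | inj₂ (j , p) = j , eventually-map dne p

    model : MonounaryAlgebra
    model = record { Carrier = B ; θ = λ (i , _) → [ proj₁ (successor i) ]ᵣ ; nonempty = [ 0 ]ᵣ }

    model-countable : Countable model
    model-countable = mk↣ {to = proj₁} B-≡

    term-value : ∀ (t : Term n) (β : Vec B n) →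
                 Eventually λ ρ → ⟦_⟧ 𝒜 t (map ρ (map proj₁ β)) ≡ ρ (proj₁ (⟦_⟧ model t β))
    term-value (var i) β = always λ ρ →
      trans (lookup-map i ρ (map proj₁ β)) (cong ρ (lookup-map i proj₁ β))
    term-value (θ· t)  β =
      let i = proj₁ (⟦_⟧ model t β); j , p = successor i in
      eventually-zip (λ e f → trans (cong (θ 𝒜) e) f) (term-value t β)
        (eventually-zip (λ e f → trans (sym e) f) p (rep-equal j))

    instance-of : Formula n → Vec B n → Instance
    instance-of φ β = _ , φ , map proj₁ β

    -- Henkin's truth lemma, proved with its converse because an implication needs the converse at
    -- its antecedent. Completeness of the limit handles implications, and Henkin witnesses handle
    -- quantifiers.
    truth : ∀ (φ : Formula n) β → Satisfies model β φ → Eventually (_⊩ instance-of φ β)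
    truth⁻ : ∀ (φ : Formula n) β → Eventually (_⊩ instance-of φ β) → Satisfies model β φ
    truth (s ≈′ t) β eq =
      eventually-zip (λ {ρ} e f → trans e (trans (cong (ρ ∘ proj₁) eq) (sym f)))
        (term-value s β) (term-value t β)
    truth (φ ⇒′ ψ) β f with eventually-decided (instance-of φ β)
    ... | inj₁ p = eventually-map (λ q _ → q) (truth ψ β (f (truth⁻ φ β p)))
    ... | inj₂ p = eventually-map (λ ¬q q → ⊥-elim (¬q q)) p
    truth (∀′ φ) β f with eventually-witnessed φ (map proj₁ β)
    ... | inj₁ p       = p
    -- The representative of the counterexample `i` belongs to the model, where `φ` is true by
    -- assumption.
    ... | inj₂ (i , p) = ⊥-elim (proj₂ (proj₂ (eventually-satisfiable
      (eventually-zip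
        (λ {ρ} q (e , ¬q) → subst (λ a → ¬ Satisfies 𝒜 (a ∷ map ρ (map proj₁ β)) φ) e ¬q q)
        (truth φ ([ i ]ᵣ ∷ β) (f [ i ]ᵣ)) (eventually-zip _,_ (rep-equal i) p)) 0)))
    truth⁻ (s ≈′ t) β p = B-≡ (trans (sym (proj₂ (⟦_⟧ model s β))) (trans (rep-cong
      (eventually-zip (λ e f → trans (sym e) f) (term-value s β)
        (eventually-zip trans p (term-value t β)))) (proj₂ (⟦_⟧ model t β))))
    truth⁻ ⊥′       β p = proj₂ (proj₂ (eventually-satisfiable p 0))
    truth⁻ (φ ⇒′ ψ) β p q = truth⁻ ψ β (eventually-zip (λ f → f) p (truth φ β q))
    truth⁻ (∀′ φ)   β p b = truth⁻ φ (b ∷ β) (eventually-map (λ f → f _) p)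

    equivalent : 𝒜 ≡ₑ model
    equivalent φ = mk⇔ (λ p → truth⁻ φ [] (always λ _ → p))
                       (λ p → proj₂ (proj₂ (eventually-satisfiable (truth φ [] p) 0)))

-- From types to ω-categoricity and back.

module _ (em : ExcludedMiddle 0ℓ) {𝒜 : MonounaryAlgebra} (𝒜-countable : Countable 𝒜) where

  open Classical em
  open Counting em
  open Instances 𝒜
  open Projection em

  private
    A = Carrier 𝒜

    code : A → ℕ
    code = Injection.to 𝒜-countable

  finitelyManyTypes⇒ωCategorical : (∀ n → FinitelyManyTypes 𝒜 n) → ωCategorical 𝒜
  finitelyManyTypes⇒ωCategorical finite ℬ ℬ-countable 𝒜≡ₑℬ =
    proj₁ (BackAndForth.isomorphism {𝒜} {ℬ} 𝒜-countable ℬ-countable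
      (isolated⇒forth {𝒜 = 𝒜} {ℬ = ℬ} λ v → separate-types (finite _) 𝒜 v)
      (finitelyManyTypes⇒back {𝒜 = 𝒜} {ℬ = ℬ} finite)
      (0 , [] , [] , λ φ → Equivalence.to (𝒜≡ₑℬ φ)))

  isolated⇒homogeneous : (∀ {n} (v : Vec A n) → Isolated 𝒜 v) →
    ∀ {a b} → SameType 𝒜 (a ∷ []) 𝒜 (b ∷ []) → SameOrbit 𝒜 a b
  isolated⇒homogeneous isolated {a} {b} a~b =
    let f , extends = BackAndForth.isomorphism {𝒜} {𝒜} 𝒜-countable 𝒜-countable
                        (isolated⇒forth {𝒜 = 𝒜} {ℬ = 𝒜} isolated)
                        (isolated⇒forth {𝒜 = 𝒜} {ℬ = 𝒜} isolated)
                        (1 , a ∷ [] , b ∷ [] , a~b)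
    in f , extends (zero , refl , refl)

  finitelyManyTypes⇒locallyFinite : FinitelyManyTypes 𝒜 2 → LocallyFinite 𝒜
  finitelyManyTypes⇒locallyFinite (ts , covers) S (xs , S⊆⟨xs⟩ , _) =
    concatMap orbit xs , listed ∘ S⊆⟨xs⟩
    where
    θ^_ : ℕ → Term 2
    θ^ zero  = var zero
    θ^ suc k = θ· (θ^ k)

    ⟦θ^⟧ : ∀ k {x y} → ⟦_⟧ 𝒜 (θ^ k) (x ∷ y ∷ []) ≡ power 𝒜 k x
    ⟦θ^⟧ zero    = refl
    ⟦θ^⟧ (suc k) = cong (θ 𝒜) (⟦θ^⟧ k)

    repeats : ∀ x → ∃[ i ] ∃[ j ] i < j × power 𝒜 i x ≡ power 𝒜 j x
    repeats x =
      let i , j , i<j , t , p , q = pigeonhole-cover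
            {P = λ k t → SameType 𝒜 t 𝒜 (x ∷ power 𝒜 k x ∷ [])} ts
            (λ k → covers (x ∷ power 𝒜 k x ∷ []))
          φ = (θ^ i) ≈′ var (suc zero)
      -- The formula saying that `θⁱ x` is the second coordinate passes from `(x , θⁱ x)` through
      -- `t` to `(x , θʲ x)`.
      in i , j , i<j , trans (sym (⟦θ^⟧ i)) (q φ (SameType-sym {𝒜 = 𝒜} {ℬ = 𝒜} p φ (⟦θ^⟧ i)))

    orbit : A → List A
    orbit x = applyUpTo (λ k → power 𝒜 k x) (proj₁ (proj₂ (repeats x)))

    orbit-closed : ∀ {x y} → y ∈ orbit x → θ 𝒜 y ∈ orbit x
    orbit-closed {x} y∈ with k , k<N , refl ← ∈-applyUpTo⁻ (λ k → power 𝒜 k x) y∈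
      with m≤n⇒m<n∨m≡n k<N
    ... | inj₁ k+1<N = ∈-applyUpTo⁺ (λ k → power 𝒜 k x) k+1<N
    -- The last listed point is sent back to the listed point `θⁱ x`.
    ... | inj₂ k+1≡N = let i , N , i<N , eq = repeats x in
      subst (_∈ orbit x) (trans eq (cong (λ k → power 𝒜 k x) (sym k+1≡N)))
        (∈-applyUpTo⁺ (λ k → power 𝒜 k x) i<N)

    listed : ∀ {y} → ⟨_⟩ 𝒜 xs y → y ∈ concatMap orbit xs
    listed (generator x∈xs) = Any.concatMap⁺ orbit (lose x∈xs
      (∈-applyUpTo⁺ _ (≤-trans (s≤s z≤n) (proj₁ (proj₂ (proj₂ (repeats _)))))))
    listed (apply p) = Any.concatMap⁺ orbit
      (Any.map orbit-closed (Any.concatMap⁻ orbit {xs = xs} (listed p)))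

  -- The type of `x` is read off the first coordinate of the diagonal pair `(x , x)`.
  pairTypes⇒types : FinitelyManyTypes 𝒜 2 → FinitelyManyTypes 𝒜 1
  pairTypes⇒types (ts , covers) = mapₗ first ts ,
    λ { (x ∷ []) → Any.map⁺ (Any.map (λ {t} → restrict t) (covers (x ∷ x ∷ []))) }
    where
    first : Vec A 2 → Vec A 1
    first t = head t ∷ []

    restrict : ∀ t {u} → SameType 𝒜 t 𝒜 u → SameType 𝒜 (first t) 𝒜 (first u)
    restrict (_ ∷ _) {_ ∷ _} t~u φ p =
      Equivalence.to (Satisfies-rename (zero ∷ []) _ φ refl)
        (t~u (rename (zero ∷ []) φ) (Equivalence.from (Satisfies-rename (zero ∷ []) _ φ refl) p))

  module _ (categorical : ωCategorical 𝒜) where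

    -- Otherwise some countable model omits the type of v, which 𝒜 realises.
    ωCategorical⇒isolated : (v : Vec A n) → Isolated 𝒜 v
    ωCategorical⇒isolated {n} v = dne omits
      where
      Omitted : Vec ℕ n → List Instance → Set
      Omitted ı L = ∃[ ψ ] Satisfies 𝒜 v ψ × (∀ {ρ} → ρ ⊩* L → ρ ⊩ (n , ¬′ ψ , ı))

      -- With trivial constraints, consistency is satisfiability in `𝒜`. Each tuple `ı` of names is
      -- a goal, met by denying it some formula of the type of `v`.
      open Henkin em 𝒜 (λ _ _ → ⊤) _ 0 _ (λ _ → (λ _ → MonounaryAlgebra.nonempty 𝒜) , tt)
        {Vec ℕ n} (mk↣ vecCode-injective) Omitted

      module _ (non-isolated : ¬ Isolated 𝒜 v) where

        omit : ∀ ı {L} → Consistent L → ∃[ h ] Consistent (h ∷ L) × Omitted ı (h ∷ L)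
        omit ı {L} con with em {∃[ ψ ] Satisfies 𝒜 v ψ × Consistent ((n , ¬′ ψ , ı) ∷ L)}
        ... | yes (ψ , p , con′) = _ , con′ , ψ , p , All.head
        -- If `L` admits no such denial, it implies the whole type of `v` at `ı`, and that type
        -- would be isolated.
        ... | no none = contradiction
          (implied-type⇒isolated ı (let ρ , _ , p = con 0 in ρ , p)
            λ ψ p {ρ} r → dne λ ¬q → none (ψ , p , λ _ → ρ , tt , ¬q ∷ r))
          non-isolated

        open Limit omit

        omits : ⊥
        omits =
          -- The isomorphism sends `v` to a tuple `β` of names, at which the type of `v` has been
          -- omitted.
          let f        = categorical model model-countable equivalent
              β        = map (Inverse.to (proj₁ f)) v
              k , ψ , p , q = goal-met (map proj₁ β)
          in truth⁻ (¬′ ψ) β (k , q) (≅⇒SameType {𝒜} {model} f v ψ p)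

    -- Otherwise, by compactness, some countable model has a pair realising none
    -- of the types of pairs of 𝒜.
    ωCategorical⇒finitelyManyPairTypes : FinitelyManyTypes 𝒜 2
    ωCategorical⇒finitelyManyPairTypes = dne realises
      where
      below : ℕ → List A
      below k = proj₁ (representatives (λ a c → code a ≡ c) (upTo k))

      below-complete : ∀ {k a} → code a < k → a ∈ below k
      below-complete {k} a<k = Any.map
        (λ (_ , p , q) → Injection.injective 𝒜-countable (trans p (sym q)))
        (proj₂ (representatives (λ a c → code a ≡ c) (upTo k)) (∈-upTo⁺ a<k))

      -- The names 0 and 1 are reserved for the new pair. Each `k` forbids finitely many types only,
      -- so it is satisfiable as long as there are infinitely many.
      New : ℕ → (ℕ → A) → Set
      New k ρ = ∀ a b → code a < k → code b < k → ¬ SameType 𝒜 (a ∷ b ∷ []) 𝒜 (ρ 0 ∷ ρ 1 ∷ [])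

      New-local : ∀ {k ρ ρ′} → Agree 2 ρ ρ′ → New k ρ → New k ρ′
      New-local agree new a b a< b< = subst (λ v → ¬ SameType 𝒜 (a ∷ b ∷ []) 𝒜 v)
        (cong₂ (λ x y → x ∷ y ∷ []) (agree (s≤s z≤n)) (agree (s≤s (s≤s z≤n)))) (new a b a< b<)

      module _ (infinite : ¬ FinitelyManyTypes 𝒜 2) where

        New-satisfiable : ∀ k → ∃[ ρ ] New k ρ
        New-satisfiable k = dne λ none → infinite
          (mapₗ (λ (a , b) → a ∷ b ∷ []) (cartesianProduct (below k) (below k)) , λ where
            (x ∷ y ∷ []) → dne λ uncovered → none ((λ { zero → x ; (suc _) → y }) ,
              λ a b a< b< same → uncovered (lose
                (∈-map⁺ _ (∈-cartesianProduct⁺ (below-complete a<) (below-complete b<))) same)))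

        open Henkin em 𝒜 New
          (λ k≤l new a b a< b< → new a b (≤-trans a< k≤l) (≤-trans b< k≤l))
          2 New-local New-satisfiable ⊥-countable (λ _ _ → ⊤)
        open Limit (λ ())

        realises : ⊥
        realises =
          let f = categorical model model-countable equivalent
              open Inverse (proj₁ f) using (to; from; strictlyInverseˡ)
              a = from [ 0 ]ᵣ
              b = from [ 1 ]ᵣ
              χ , p , isolates = ωCategorical⇒isolated (a ∷ b ∷ [])
              q = truth χ ([ 0 ]ᵣ ∷ [ 1 ]ᵣ ∷ [])
                    (subst (λ v → Satisfies model v χ)
                      (cong₂ (λ x y → x ∷ y ∷ []) (strictlyInverseˡ [ 0 ]ᵣ) (strictlyInverseˡ [ 1 ]ᵣ))
                      (≅⇒SameType {𝒜} {model} f (a ∷ b ∷ []) χ p))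
              -- This index exceeds both codes, so `new` forbids the type of `(a , b)` at the names
              -- 0 and 1, whereas `χ` holds there and isolates exactly that type.
              ρ , new , r , e₀ , e₁ = eventually-satisfiable
                (eventually-zip _,_ q (eventually-zip _,_ (rep-equal 0) (rep-equal 1)))
                (suc (code a ⊔ code b))
          in new a b (s≤s (m≤m⊔n (code a) (code b))) (s≤s (m≤n⊔m (code a) (code b)))
               (isolates (ρ 0 ∷ ρ 1 ∷ [])
                 (subst (λ v → Satisfies 𝒜 v χ) (cong₂ (λ x y → x ∷ y ∷ []) (sym e₀) (sym e₁)) r))

    ωCategorical⇒finitelyMany1Orbits : FinitelyMany1Orbits 𝒜
    ωCategorical⇒finitelyMany1Orbits =
      let ts , covers = pairTypes⇒types ωCategorical⇒finitelyManyPairTypes in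
      mapₗ head ts , λ x → Any.map⁺ (Any.map
        (λ { {_ ∷ []} → isolated⇒homogeneous ωCategorical⇒isolated }) (covers (x ∷ [])))

theorem5p10 : ExcludedMiddle 0ℓ → (𝒜 : MonounaryAlgebra) → Countable 𝒜 → ωCategorical 𝒜 ⇔ (LocallyFinite 𝒜 × FinitelyMany1Orbits 𝒜)
theorem5p10 em 𝒜 𝒜-countable = mk⇔
  (λ categorical →
    finitelyManyTypes⇒locallyFinite em 𝒜-countable
      (ωCategorical⇒finitelyManyPairTypes em 𝒜-countable categorical) ,
    ωCategorical⇒finitelyMany1Orbits em 𝒜-countable categorical)
  (λ (locallyFinite , finiteOrbits) → finitelyManyTypes⇒ωCategorical em 𝒜-countable λ n →
    finitelyManyOrbits⇒types (Counting.finitelyManyOrbits em locallyFinite finiteOrbits n))
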